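{- Let $\vec d=(\vec a,\vec b)$ be a bidegree sequence of length $n$ with $\sum_{i=1}^n a_i=\sum_{i=1}^n b_i=n\bar c$. Suppose $M_a,M_b\in\mathbb{N}$ satisfy $\max_i a_i\le M_a$, $\max_i b_i\le M_b$ and $(M_a+1)M_b\le n\bar c$. Then $\vec d$ is graphic. In particular, if $\max\vec d\le\sqrt{\tfrac14+n\bar c}-\tfrac12$, then $\vec d$ is graphic.
   Context: A bidegree sequence of length $n$ is a pair $\vec d=(\vec a,\vec b)$ with $\vec a=(a_1,\dots,a_n)\in\mathbb{N}_0^n$ and $\vec b=(b_1,\dots,b_n)\in\mathbb{N}_0^n$. It is graphic with loops if there is an $n\times n$ matrix with entries in $\{0,1\}$ whose $i$th row sum is $a_i$ and whose $i$th column sum is $b_i$ for every $i\in[1..n]$; it is graphic if such a matrix exists with all diagonal entries equal to $0$. $\max\vec d$ and $\min\vec d$ denote the maximum and minimum over all $2n$ entries $a_1,\dots,a_n,b_1,\dots,b_n$. The number $\bar c$ (the average degree) is defined by $\sum_i a_i=\sum_i b_i=n\bar c$. -}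

module Defs where

open import Data.Fin using (Fin; zero; toℕ)
open import Data.Integer using (+_)
open import Data.Nat using (ℕ; _⊔_)
open import Data.Nat.Properties using (+-0-monoid)
open import Data.Product using (_×_; _,_; ∃-syntax)
open import Data.Rational using (ℚ; 0ℚ; _/_; _+_; _*_; _<_)
open import Data.Sum using (_⊎_)
open import Data.Vec.Functional using (Vector; foldr)
open import Relation.Binary.PropositionalEquality using (_≡_)

open import Algebra.Properties.Monoid.Sum +-0-monoid public using (sum)

BidegreeSequence : ℕ → Set
BidegreeSequence n = Vector ℕ n × Vector ℕ n

ZeroOneMatrix : ℕ → Set
ZeroOneMatrix n = Fin n → Fin n → Fin 2

Realises : ∀ {n} → ZeroOneMatrix n → BidegreeSequence n → Set
Realises A (a , b) =
  (∀ i → sum (λ j → toℕ (A i j)) ≡ a i) ×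
  (∀ j → sum (λ i → toℕ (A i j)) ≡ b j)

Graphic : ∀ {n} → BidegreeSequence n → Set
Graphic {n} d = ∃[ A ] Realises {n} A d × (∀ i → A i i ≡ zero)

-- The maximum of the empty vector is 0.
maximum : ∀ {n} → Vector ℕ n → ℕ
maximum = foldr _⊔_ 0

maxDegree : ∀ {n} → BidegreeSequence n → ℕ
maxDegree (a , b) = maximum a ⊔ maximum b

fromℕ : ℕ → ℚ
fromℕ m = + m / 1

¼ : ℚ
¼ = + 1 / 4

-- The standard library has no real numbers.  A real x is represented by its
-- open lower Dedekind cut { q ∈ ℚ ∣ q < x }, and x ≤ y is inclusion of cuts.
Real : Set₁
Real = ℚ → Set

infix 4 _≤ᴿ_
_≤ᴿ_ : Real → Real → Set
x ≤ᴿ y = ∀ q → x q → y q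

fromℚ : ℚ → Real
fromℚ r q = q < r

-- For r ≥ 0, q < √ r holds exactly when q < 0 or q² < r.
-- For r < 0 this definition gives the value 0.
infix 8 √_
√_ : ℚ → Real
(√ r) q = q < 0ℚ ⊎ q * q < r

-- Subtraction of a rational: q < x - r exactly when q + r < x.
infixl 6 _-ᴿ_
_-ᴿ_ : Real → ℚ → Real
(x -ᴿ r) q = x (q + r)

{-# OPTIONS --safe #-}

-- Let m = Σ aᵢ = Σ bⱼ.  A loopless 0-1 matrix exists as soon as
--   Σ_R a + Σ_W b + |R ∩ W| ≤ m + |R| |W|   for all sets R of rows and W of columns.
-- To see this, start from a loopless matrix with the prescribed row sums.  If
-- column s is too large, let C be the set of columns to which a unit of column s
-- can be rerouted by successive shifts within rows.  If no column in C is smaller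
-- than prescribed, then R = rows meeting C and W = complement of C violate the
-- inequality; otherwise reroute a unit to a column that is too small.
--
-- The degree bounds imply the inequality.  If |R| > M_b, bound Σ_R a by m and
-- Σ_W b by |W| M_b; if |W| > M_a, argue symmetrically; otherwise the left side is
-- at most |R| M_a + |W| M_b + |R| ≤ M_a M_b + M_b + |R| |W|.
module Submission where

open import Defs
open import Data.Nat as ℕ using (ℕ)
open import Data.Product using (_×_; _,_)
open import Data.Rational using (ℚ; ½; _+_; _*_; _≤_)
open import Data.Vec.Functional using (Vector)
open import Relation.Binary.PropositionalEquality using (_≡_)

open import Data.Bool using (Bool; true; false; not; _∨_; if_then_else_)
import Data.Bool.Properties as Bool
open import Data.Fin using (Fin; zero; suc; toℕ; punchIn)
open import Data.Fin.Patterns using (0F; 1F)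
open import Data.Fin.Properties using (_≟_; any?; punchInᵢ≢i)
open import Data.Nat using (zero; suc; z≤n; s≤s; _∸_)
import Data.Nat.Properties as ℕₚ
import Data.Integer as ℤ
import Data.Integer.Properties as ℤₚ
import Data.Nat.Coprimality as Coprimality
open import Data.Rational using (mkℚ; 0ℚ; 1ℚ; 1/_; _-_; _<_; *≤*; _/_; Positive)
import Data.Rational.Properties as ℚₚ
open import Data.Rational.Solver using (module +-*-Solver)
open import Data.Nat.Tactic.RingSolver using (solve-∀)
open import Data.Product using (∃-syntax; Σ-syntax; proj₁; proj₂)
open import Data.Sum using (inj₁; inj₂)
open import Data.Vec.Functional using (insertAt; removeAt)
open import Data.Vec.Functional.Properties using (insertAt-lookup; removeAt-insertAt)
open import Function using (_∘_; const; case_of_)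
open import Relation.Binary.PropositionalEquality
  using (_≢_; refl; sym; trans; cong; cong₂; subst; subst₂; module ≡-Reasoning)
open import Relation.Nullary using (¬_; yes; no; does; Dec; contradiction)
open import Relation.Nullary.Decidable using (_×-dec_; ¬?; dec-false; dec-true)

open import Algebra.Properties.CommutativeSemigroup ℕₚ.+-commutativeSemigroup
  using () renaming (xy∙z≈xz∙y to swap)
open import Algebra.Properties.Semiring.Sum ℕₚ.+-*-semiring
  using (sum-remove; ∑-distrib-+; ∑-comm; sum-cong-≗; *-distribˡ-sum; *-distribʳ-sum; sum-replicate-zero)

private
  variable
    n : ℕ

-- Comparison of finite sums.

sum-mono-≤ : {f g : Vector ℕ n} → (∀ i → f i ℕ.≤ g i) → sum f ℕ.≤ sum g
sum-mono-≤ {zero}  f≤g = z≤n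
sum-mono-≤ {suc n} f≤g = ℕₚ.+-mono-≤ (f≤g 0F) (sum-mono-≤ (f≤g ∘ suc))

term≤sum : (f : Vector ℕ n) → ∀ i → f i ℕ.≤ sum f
term≤sum f zero    = ℕₚ.m≤m+n _ _
term≤sum f (suc i) = ℕₚ.m≤n⇒m≤o+n (f 0F) (term≤sum (f ∘ suc) i)

-- Serves a row of a matrix, where the diagonal position is the one place at which the termwise
-- bound may fail; `c` pays for it.
sum-mono-except : {f g : Vector ℕ n} (i : Fin n) (c : ℕ) →
  (∀ j → j ≢ i → f j ℕ.≤ g j) → f i ℕ.≤ g i ℕ.+ c → sum f ℕ.≤ sum g ℕ.+ c
sum-mono-except {suc n} {f} {g} i c f≤g fᵢ≤gᵢ+c = begin
  sum f                               ≡⟨ sum-remove f ⟩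
  f i ℕ.+ sum (removeAt f i)          ≤⟨ ℕₚ.+-mono-≤ fᵢ≤gᵢ+c (sum-mono-≤ (λ j → f≤g _ (punchInᵢ≢i i j))) ⟩
  g i ℕ.+ c ℕ.+ sum (removeAt g i)    ≡⟨ swap (g i) c _ ⟩
  g i ℕ.+ sum (removeAt g i) ℕ.+ c    ≡⟨ cong (ℕ._+ c) (sum-remove g) ⟨
  sum g ℕ.+ c                         ∎
  where open ℕₚ.≤-Reasoning

sum-mono-< : {f g : Vector ℕ n} (i : Fin n) → (∀ j → f j ℕ.≤ g j) → f i ℕ.< g i → sum f ℕ.< sum g
sum-mono-< {suc n} {f} {g} i f≤g fᵢ<gᵢ = begin-strict
  sum f                         ≡⟨ sum-remove f ⟩
  f i ℕ.+ sum (removeAt f i)    <⟨ ℕₚ.+-mono-<-≤ fᵢ<gᵢ (sum-mono-≤ {f = removeAt f i} (λ j → f≤g (punchIn i j))) ⟩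
  g i ℕ.+ sum (removeAt g i)    ≡⟨ sum-remove g ⟨
  sum g                         ∎
  where open ℕₚ.≤-Reasoning

-- Stated additively, like the balance equations below, to avoid truncated subtraction.
sum-differ : {f g : Vector ℕ n} (i : Fin n) → (∀ j → j ≢ i → f j ≡ g j) → sum f ℕ.+ g i ≡ sum g ℕ.+ f i
sum-differ {suc n} {f} {g} i f≡g = begin
  sum f ℕ.+ g i                         ≡⟨ cong (ℕ._+ g i) (sum-remove f) ⟩
  f i ℕ.+ sum (removeAt f i) ℕ.+ g i    ≡⟨ cong (λ s → f i ℕ.+ s ℕ.+ g i) (sum-cong-≗ (λ j → f≡g _ (punchInᵢ≢i i j))) ⟩
  f i ℕ.+ sum (removeAt g i) ℕ.+ g i    ≡⟨ reverse (f i) _ (g i) ⟩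
  g i ℕ.+ sum (removeAt g i) ℕ.+ f i    ≡⟨ cong (ℕ._+ f i) (sum-remove g) ⟨
  sum g ℕ.+ f i                         ∎
  where
  open ≡-Reasoning
  reverse : ∀ x y z → x ℕ.+ y ℕ.+ z ≡ z ℕ.+ y ℕ.+ x
  reverse = solve-∀

-- Indicators and sums over subsets.

χ : Bool → ℕ
χ b = if b then 1 else 0

δ : Fin n → Fin n → ℕ
δ i j = χ (does (i ≟ j))

δ-diag : (i : Fin n) → δ i i ≡ 1
δ-diag i = cong χ (dec-true (i ≟ i) refl)

δ-off : {i j : Fin n} → i ≢ j → δ i j ≡ 0
δ-off {i = i} {j} i≢j = cong χ (dec-false (i ≟ j) i≢j)

sum-δ : (i : Fin n) → sum (δ i) ≡ 1
sum-δ {suc n} i = begin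
  sum (δ i)                              ≡⟨ sum-remove {i = i} (δ i) ⟩
  δ i i ℕ.+ sum (removeAt (δ i) i)       ≡⟨ cong₂ ℕ._+_ (δ-diag i) (sum-cong-≗ (λ j → δ-off (punchInᵢ≢i i j ∘ sym))) ⟩
  1 ℕ.+ sum {n} (const 0)                ≡⟨ cong suc (sum-replicate-zero n) ⟩
  1                                      ∎
  where open ≡-Reasoning

size : Vector Bool n → ℕ
size X = sum (χ ∘ X)

sumOver : Vector Bool n → Vector ℕ n → ℕ
sumOver X f = sum (λ i → χ (X i) ℕ.* f i)

χ-*-≤ : ∀ x m → χ x ℕ.* m ℕ.≤ m
χ-*-≤ false m = z≤n
χ-*-≤ true  m = ℕₚ.≤-reflexive (ℕₚ.*-identityˡ m)

sumOver-≤-sum : (X : Vector Bool n) (f : Vector ℕ n) → sumOver X f ℕ.≤ sum f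
sumOver-≤-sum X f = sum-mono-≤ (λ i → χ-*-≤ (X i) (f i))

sumOver-≤-* : (X : Vector Bool n) (f : Vector ℕ n) (m : ℕ) → (∀ i → f i ℕ.≤ m) → sumOver X f ℕ.≤ size X ℕ.* m
sumOver-≤-* X f m f≤m = begin
  sumOver X f                    ≤⟨ sum-mono-≤ (λ i → ℕₚ.*-monoʳ-≤ (χ (X i)) (f≤m i)) ⟩
  sum (λ i → χ (X i) ℕ.* m)      ≡⟨ *-distribʳ-sum m (χ ∘ X) ⟨
  size X ℕ.* m                   ∎
  where open ℕₚ.≤-Reasoning

sumOver-complement : (X : Vector Bool n) (f : Vector ℕ n) → sumOver X f ℕ.+ sumOver (not ∘ X) f ≡ sum f
sumOver-complement X f = trans
  (sym (∑-distrib-+ (λ i → χ (X i) ℕ.* f i) (λ i → χ (not (X i)) ℕ.* f i)))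
  (sum-cong-≗ (λ i → eq (X i) (f i)))
  where
  eq : ∀ x m → χ x ℕ.* m ℕ.+ χ (not x) ℕ.* m ≡ m
  eq false m = ℕₚ.*-identityˡ m
  eq true  m = trans (ℕₚ.+-identityʳ _) (ℕₚ.*-identityˡ m)

-- Row and column sums, and rows with a prescribed sum.

rowSum colSum : ZeroOneMatrix n → Vector ℕ n
rowSum A i = sum (λ j → toℕ (A i j))
colSum A j = sum (λ i → toℕ (A i j))

sum-colSum : (A : ZeroOneMatrix n) → sum (colSum A) ≡ sum (rowSum A)
sum-colSum A = ∑-comm (λ j i → toℕ (A i j))

prefix : ℕ → Vector (Fin 2) n
prefix zero    _       = 0F
prefix (suc m) zero    = 1F
prefix (suc m) (suc j) = prefix m j

sum-prefix : ∀ m → m ℕ.≤ n → sum {n} (toℕ ∘ prefix m) ≡ m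
sum-prefix {n}     zero    _         = sum-replicate-zero n
sum-prefix {suc n} (suc m) (s≤s m≤n) = cong suc (sum-prefix m m≤n)

-- All ones go into the `n - 1` positions other than `i`, and the zero is then inserted at `i`; this
-- is why `m` must be less than `n`.
row-avoiding : (i : Fin n) (m : ℕ) → m ℕ.< n → Σ[ r ∈ Vector (Fin 2) n ] r i ≡ 0F × sum (toℕ ∘ r) ≡ m
row-avoiding {suc n} i m (s≤s m≤n) = r , rᵢ≡0 , (begin
  sum (toℕ ∘ r)                                 ≡⟨ sum-remove {i = i} (toℕ ∘ r) ⟩
  toℕ (r i) ℕ.+ sum (removeAt (toℕ ∘ r) i)      ≡⟨ cong₂ ℕ._+_ (cong toℕ rᵢ≡0)
                                                     (sum-cong-≗ (λ j → cong toℕ (removeAt-insertAt (prefix m) i 0F j))) ⟩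
  sum (toℕ ∘ prefix {n} m)                      ≡⟨ sum-prefix m m≤n ⟩
  m                                             ∎)
  where
  open ≡-Reasoning
  r : Vector (Fin 2) (suc n)
  r = insertAt (prefix m) i 0F
  rᵢ≡0 : r i ≡ 0F
  rᵢ≡0 = insertAt-lookup (prefix m) i 0F

-- Shifting one unit within a row.

shift : Vector (Fin 2) n → Fin n → Fin n → Vector (Fin 2) n
shift r k l j = if does (l ≟ j) then 1F else if does (k ≟ j) then 0F else r j

module _ (r : Vector (Fin 2) n) {k l : Fin n} where

  shift-δ : r k ≡ 1F → r l ≡ 0F → ∀ j → toℕ (shift r k l j) ℕ.+ δ k j ≡ toℕ (r j) ℕ.+ δ l j
  shift-δ rₖ≡1 rₗ≡0 j with l ≟ j | k ≟ j
  ... | yes refl | yes refl = contradiction (trans (sym rₖ≡1) rₗ≡0) λ()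
  ... | yes refl | no _     rewrite rₗ≡0 = refl
  ... | no _     | yes refl rewrite rₖ≡1 = refl
  ... | no _     | no _     = refl

  shift-target : shift r k l l ≡ 1F
  shift-target rewrite dec-true (l ≟ l) refl = refl

  shift-off : ∀ {j} → k ≢ j → l ≢ j → shift r k l j ≡ r j
  shift-off {j} k≢j l≢j rewrite dec-false (l ≟ j) l≢j | dec-false (k ≟ j) k≢j = refl

  shift-zero : ∀ {j} → l ≢ j → r j ≡ 0F → shift r k l j ≡ 0F
  shift-zero {j} l≢j rⱼ≡0 rewrite dec-false (l ≟ j) l≢j with does (k ≟ j)
  ... | true  = refl
  ... | false = rⱼ≡0

sum-transfer : {f g : Vector ℕ n} (k l : Fin n) → (∀ j → f j ℕ.+ δ k j ≡ g j ℕ.+ δ l j) → sum f ≡ sum g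
sum-transfer {f = f} {g} k l f+δ≡g+δ = ℕₚ.+-cancelʳ-≡ 1 _ _ (begin
  sum f ℕ.+ 1                ≡⟨ cong (sum f ℕ.+_) (sum-δ k) ⟨
  sum f ℕ.+ sum (δ k)        ≡⟨ ∑-distrib-+ f (δ k) ⟨
  sum (λ j → f j ℕ.+ δ k j)  ≡⟨ sum-cong-≗ f+δ≡g+δ ⟩
  sum (λ j → g j ℕ.+ δ l j)  ≡⟨ ∑-distrib-+ g (δ l) ⟩
  sum g ℕ.+ sum (δ l)        ≡⟨ cong (sum g ℕ.+_) (sum-δ l) ⟩
  sum g ℕ.+ 1                ∎)
  where open ≡-Reasoning

move : ZeroOneMatrix n → Fin n → Fin n → Fin n → ZeroOneMatrix n
move A i k l i′ = if does (i ≟ i′) then shift (A i) k l else A i′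

module _ (A : ZeroOneMatrix n) {i k l : Fin n} where

  move-at : ∀ j → move A i k l i j ≡ shift (A i) k l j
  move-at j rewrite dec-true (i ≟ i) refl = refl

  move-off : ∀ {i′} → i ≢ i′ → ∀ j → move A i k l i′ j ≡ A i′ j
  move-off {i′} i≢i′ j rewrite dec-false (i ≟ i′) i≢i′ = refl

  module _ (Aᵢₖ≡1 : A i k ≡ 1F) (Aᵢₗ≡0 : A i l ≡ 0F) where

    rowSum-move : ∀ i′ → rowSum (move A i k l) i′ ≡ rowSum A i′
    rowSum-move i′ with i ≟ i′
    ... | yes refl = sum-transfer k l (shift-δ (A i) Aᵢₖ≡1 Aᵢₗ≡0)
    ... | no _     = refl

    colSum-move : ∀ j → colSum (move A i k l) j ℕ.+ δ k j ≡ colSum A j ℕ.+ δ l j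
    -- With the old entry at `(i , j)` added to both sides, `sum-differ` reduces the claim to the
    -- single entry in row `i`, where `shift-δ` applies.
    colSum-move j = ℕₚ.+-cancelʳ-≡ (toℕ (A i j)) _ _ (begin
      c′ ℕ.+ δ k j ℕ.+ x   ≡⟨ swap c′ _ x ⟩
      c′ ℕ.+ x ℕ.+ δ k j   ≡⟨ cong (ℕ._+ δ k j) (sum-differ i (λ i′ i′≢i → cong toℕ (move-off (i′≢i ∘ sym) j))) ⟩
      c ℕ.+ x′ ℕ.+ δ k j   ≡⟨ ℕₚ.+-assoc c _ _ ⟩
      c ℕ.+ (x′ ℕ.+ δ k j) ≡⟨ cong (c ℕ.+_) (trans (cong (λ v → toℕ v ℕ.+ δ k j) (move-at j)) (shift-δ (A i) Aᵢₖ≡1 Aᵢₗ≡0 j)) ⟩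
      c ℕ.+ (x ℕ.+ δ l j)  ≡⟨ swap′ c x _ ⟩
      c ℕ.+ δ l j ℕ.+ x    ∎)
      where
      open ≡-Reasoning
      c c′ x x′ : ℕ
      c  = colSum A j
      c′ = colSum (move A i k l) j
      x  = toℕ (A i j)
      x′ = toℕ (move A i k l i j)
      swap′ : ∀ x y z → x ℕ.+ (y ℕ.+ z) ≡ x ℕ.+ z ℕ.+ y
      swap′ = solve-∀

-- Rerouting units along paths of shifts.

insert : Vector Bool n → Fin n → Vector Bool n
insert C l j = does (l ≟ j) ∨ C j

insert-self : (C : Vector Bool n) (l : Fin n) → insert C l l ≡ true
insert-self C l rewrite dec-true (l ≟ l) refl = refl

insert-⊇ : (C : Vector Bool n) (l j : Fin n) → C j ≡ true → insert C l j ≡ true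
insert-⊇ C l j Cⱼ rewrite Cⱼ = Bool.∨-zeroʳ _

-- A′ arises from A by moving one unit from column s to column k; the last two
-- fields let the rerouting be continued along an edge from k out of C.
record Reroute (A : ZeroOneMatrix n) (s : Fin n) (C : Vector Bool n) (k : Fin n) : Set where
  field
    A′       : ZeroOneMatrix n
    diagonal : ∀ i → A′ i i ≡ 0F
    rows     : ∀ i → rowSum A′ i ≡ rowSum A i
    cols     : ∀ j → colSum A′ j ℕ.+ δ s j ≡ colSum A j ℕ.+ δ k j
    outside  : ∀ {j} → C j ≡ false → ∀ i → A′ i j ≡ A i j
    keeps    : ∀ {i} → A i k ≡ 1F → A′ i k ≡ 1F

-- Row `i` can shift a unit from column `k` to column `l`; `i ≢ l` keeps the diagonal zero.
Edge : ZeroOneMatrix n → Fin n → Fin n → Fin n → Set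
Edge A i k l = A i k ≡ 1F × i ≢ l × A i l ≡ 0F

Leaves : ZeroOneMatrix n → Vector Bool n → Fin n → Fin n → Fin n → Set
Leaves A C i k l = C k ≡ true × C l ≡ false × Edge A i k l

leaves? : (A : ZeroOneMatrix n) (C : Vector Bool n) → Dec (∃[ i ] ∃[ k ] ∃[ l ] Leaves A C i k l)
leaves? A C = any? λ i → any? λ k → any? λ l →
  C k Bool.≟ true ×-dec C l Bool.≟ false ×-dec A i k ≟ 1F ×-dec ¬? (i ≟ l) ×-dec A i l ≟ 0F

module _ {A : ZeroOneMatrix n} {s : Fin n} {C : Vector Bool n} where

  reroute-weaken : ∀ {k} l → Reroute A s C k → Reroute A s (insert C l) k
  reroute-weaken l ρ = record
    { Reroute ρ
    ; outside = λ {j} j∉ → Reroute.outside ρ (Bool.∨-conicalʳ (does (l ≟ j)) (C j) j∉)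
    }

  -- The edge is one of `A` but has to be used in `A′`. Its one in column `k` survives by `keeps`,
  -- and its zero in column `l` by `outside`, because `l` is not yet in `C`.
  reroute-extend : ∀ {i k l} → Leaves A C i k l → Reroute A s C k → Reroute A s (insert C l) l
  reroute-extend {i} {k} {l} (k∈C , l∉C , Aᵢₖ≡1 , i≢l , Aᵢₗ≡0) ρ = record
    { A′       = move A′ i k l
    ; diagonal = diagonal′
    ; rows     = λ i′ → trans (rowSum-move A′ A′ᵢₖ≡1 A′ᵢₗ≡0 i′) (rows i′)
    ; cols     = cols′
    ; outside  = outside′
    ; keeps    = keeps′
    }
    where
    open Reroute ρ
    A′ᵢₖ≡1 : A′ i k ≡ 1F
    A′ᵢₖ≡1 = keeps Aᵢₖ≡1
    A′ᵢₗ≡0 : A′ i l ≡ 0F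
    A′ᵢₗ≡0 = trans (outside l∉C i) Aᵢₗ≡0

    diagonal′ : ∀ i′ → move A′ i k l i′ i′ ≡ 0F
    diagonal′ i′ with i ≟ i′
    ... | yes refl = shift-zero (A′ i) {k} (i≢l ∘ sym) (diagonal i)
    ... | no _     = diagonal i′

    cols′ : ∀ j → colSum (move A′ i k l) j ℕ.+ δ s j ≡ colSum A j ℕ.+ δ l j
    cols′ j = ℕₚ.+-cancelʳ-≡ (δ k j) _ _ (begin
      colSum (move A′ i k l) j ℕ.+ δ s j ℕ.+ δ k j  ≡⟨ swap (colSum (move A′ i k l) j) (δ s j) _ ⟩
      colSum (move A′ i k l) j ℕ.+ δ k j ℕ.+ δ s j  ≡⟨ cong (ℕ._+ δ s j) (colSum-move A′ A′ᵢₖ≡1 A′ᵢₗ≡0 j) ⟩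
      colSum A′ j ℕ.+ δ l j ℕ.+ δ s j               ≡⟨ swap (colSum A′ j) (δ l j) _ ⟩
      colSum A′ j ℕ.+ δ s j ℕ.+ δ l j               ≡⟨ cong (ℕ._+ δ l j) (cols j) ⟩
      colSum A j ℕ.+ δ k j ℕ.+ δ l j                ≡⟨ swap (colSum A j) (δ k j) _ ⟩
      colSum A j ℕ.+ δ l j ℕ.+ δ k j                ∎)
      where open ≡-Reasoning

    outside′ : ∀ {j} → insert C l j ≡ false → ∀ i′ → move A′ i k l i′ j ≡ A i′ j
    outside′ {j} j∉ i′ = trans unchanged (outside j∉C i′)
      where
      j∉C : C j ≡ false
      j∉C = Bool.∨-conicalʳ (does (l ≟ j)) (C j) j∉
      k≢j : k ≢ j
      k≢j refl = contradiction (trans (sym k∈C) j∉C) λ()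
      l≢j : l ≢ j
      l≢j refl = contradiction (trans (sym (insert-self C l)) j∉) λ()
      unchanged : move A′ i k l i′ j ≡ A′ i′ j
      unchanged with i ≟ i′
      ... | yes refl = shift-off (A′ i) k≢j l≢j
      ... | no _     = refl

    keeps′ : ∀ {i′} → A i′ l ≡ 1F → move A′ i k l i′ l ≡ 1F
    keeps′ {i′} Aᵢ′ₗ≡1 with i ≟ i′
    ... | yes refl = shift-target (A′ i) {k} {l}
    ... | no _     = trans (outside l∉C i′) Aᵢ′ₗ≡1

Saturated : ZeroOneMatrix n → Fin n → Vector Bool n → Set
Saturated A s C = C s ≡ true
  × (∀ k → C k ≡ true → Reroute A s C k)
  × (∀ {i k l} → ¬ Leaves A C i k l)

-- Starting from `s` alone with the trivial rerouting, `grow` adds the end of a leaving edge while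
-- there is one. The number of columns outside the set drops each time, so the fuel suffices.
saturate : (A : ZeroOneMatrix n) → (∀ i → A i i ≡ 0F) → (s : Fin n) → ∃[ C ] Saturated A s C
saturate {n} A diag s = grow (suc (size (not ∘ C₀))) C₀ ℕₚ.≤-refl s∈C₀ start
  where
  C₀ : Vector Bool n
  C₀ j = does (s ≟ j)
  s∈C₀ : C₀ s ≡ true
  s∈C₀ = dec-true (s ≟ s) refl
  start : ∀ k → C₀ k ≡ true → Reroute A s C₀ k
  start k k∈ with s ≟ k
  ... | yes refl = record
    { A′ = A ; diagonal = diag ; rows = λ _ → refl ; cols = λ _ → refl ; outside = λ _ _ → refl ; keeps = λ eq → eq }

  grow : ∀ fuel C → size (not ∘ C) ℕ.< fuel → C s ≡ true → (∀ k → C k ≡ true → Reroute A s C k) →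
    ∃[ C′ ] Saturated A s C′
  grow (suc fuel) C (s≤s bound) s∈C ρ with leaves? A C
  ... | no none = C , s∈C , ρ , λ leaves → none (_ , _ , _ , leaves)
  ... | yes (i , k , l , leaves@(k∈C , l∉C , _)) =
    grow fuel (insert C l) (ℕₚ.<-≤-trans smaller bound) (insert-⊇ C l s s∈C) ρ′
    where
    χ-∨ : ∀ x y → χ (not (x ∨ y)) ℕ.≤ χ (not y)
    χ-∨ true  y = z≤n
    χ-∨ false y = ℕₚ.≤-refl
    smaller : size (not ∘ insert C l) ℕ.< size (not ∘ C)
    smaller = sum-mono-< l (λ j → χ-∨ (does (l ≟ j)) (C j))
      (subst₂ (λ x y → χ (not x) ℕ.< χ (not y)) (sym (insert-self C l)) (sym l∉C) (s≤s z≤n))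
    ρ′ : ∀ j → insert C l j ≡ true → Reroute A s (insert C l) j
    ρ′ j j∈ with C j Bool.≟ true
    ... | yes j∈C = reroute-weaken l (ρ j j∈C)
    ... | no  j∉C with l ≟ j
    ...   | yes refl = reroute-extend leaves (ρ k k∈C)
    ...   | no _     = contradiction j∈ j∉C

-- The cut condition and closed sets of columns.

-- The cut condition of the max-flow min-cut theorem for loopless bipartite networks.
Fulkerson : Vector ℕ n → Vector ℕ n → Set
Fulkerson {n} a b = (R W : Vector Bool n) →
  sumOver R a ℕ.+ sumOver W b ℕ.+ sumOver R (χ ∘ W) ℕ.≤ sum b ℕ.+ size R ℕ.* size W

-- Apply the cut condition to the single row `i` and all columns. They meet in one index, which
-- makes the bound strict and leaves room in row `i` for a zero on the diagonal.
cut⇒row<n : {a b : Vector ℕ n} → Fulkerson a b → ∀ i → a i ℕ.< n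
cut⇒row<n {n} {a} {b} cut i = ℕₚ.+-cancelˡ-≤ (sum b) _ _ (begin
  sum b ℕ.+ suc (a i)               ≡⟨ reorder (sum b) (a i) ⟩
  a i ℕ.+ sum b ℕ.+ 1               ≤⟨ ℕₚ.+-mono-≤ (ℕₚ.+-mono-≤ a-part b-part) meet-part ⟩
  sumOver R a ℕ.+ sumOver W b ℕ.+ sumOver R (χ ∘ W)
                                    ≤⟨ cut R W ⟩
  sum b ℕ.+ size R ℕ.* size W       ≡⟨ cong (sum b ℕ.+_) (cong₂ ℕ._*_ (sum-δ i) (sum-ones n)) ⟩
  sum b ℕ.+ 1 ℕ.* n                 ≡⟨ cong (sum b ℕ.+_) (ℕₚ.*-identityˡ n) ⟩
  sum b ℕ.+ n                       ∎)
  where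
  open ℕₚ.≤-Reasoning
  R W : Vector Bool n
  R j = does (i ≟ j)
  W _ = true
  a-part : a i ℕ.≤ sumOver R a
  a-part = begin
    a i                   ≡⟨ ℕₚ.*-identityˡ _ ⟨
    1 ℕ.* a i             ≡⟨ cong (ℕ._* a i) (δ-diag i) ⟨
    χ (R i) ℕ.* a i       ≤⟨ term≤sum (λ j → χ (R j) ℕ.* a j) i ⟩
    sumOver R a           ∎
  b-part : sum b ℕ.≤ sumOver W b
  b-part = sum-mono-≤ (λ j → ℕₚ.≤-reflexive (sym (ℕₚ.*-identityˡ (b j))))
  meet-part : 1 ℕ.≤ sumOver R (χ ∘ W)
  meet-part = begin
    1                       ≡⟨ sum-δ i ⟨
    sum (δ i)               ≡⟨ sum-cong-≗ (λ j → ℕₚ.*-identityʳ (δ i j)) ⟨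
    sumOver R (χ ∘ W)       ∎
  sum-ones : ∀ m → sum {m} (const 1) ≡ m
  sum-ones zero    = refl
  sum-ones (suc m) = cong suc (sum-ones m)
  reorder : ∀ x y → x ℕ.+ suc y ≡ y ℕ.+ x ℕ.+ 1
  reorder = solve-∀

module _ (A : ZeroOneMatrix n) (C : Vector Bool n) (closed : ∀ {i k l} → ¬ Leaves A C i k l) where

  private
    meets? : ∀ i → Dec (∃[ k ] C k ≡ true × A i k ≡ 1F)
    meets? i = any? λ k → C k Bool.≟ true ×-dec A i k ≟ 1F

    R W : Vector Bool n
    R i = does (meets? i)
    W   = not ∘ C

  -- If row `i` has a one in `C`, closedness forces ones in all columns of `W` except possibly the
  -- diagonal one, which `χ (W i)` accounts for. If it has none, both sides vanish.
  row-count : ∀ i → sumOver C (toℕ ∘ A i) ℕ.+ χ (R i) ℕ.* size W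
    ℕ.≤ χ (R i) ℕ.* rowSum A i ℕ.+ χ (R i) ℕ.* χ (W i)
  row-count i with meets? i
  ... | no none = ℕₚ.≤-reflexive (trans (ℕₚ.+-identityʳ _) (trans (sum-cong-≗ vanishes) (sum-replicate-zero n)))
    where
    vanishes : ∀ k → χ (C k) ℕ.* toℕ (A i k) ≡ 0
    vanishes k with C k in k∈C | A i k in Aᵢₖ
    ... | false | _  = refl
    ... | true  | 0F = refl
    ... | true  | 1F = contradiction (k , k∈C , Aᵢₖ) none
  ... | yes (k , k∈C , Aᵢₖ≡1) = begin
    sumOver C (toℕ ∘ A i) ℕ.+ 1 ℕ.* size W
      ≡⟨ cong (sumOver C (toℕ ∘ A i) ℕ.+_) (ℕₚ.*-identityˡ _) ⟩
    sumOver C (toℕ ∘ A i) ℕ.+ size W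
      ≡⟨ ∑-distrib-+ (λ l → χ (C l) ℕ.* toℕ (A i l)) (χ ∘ W) ⟨
    sum (λ l → χ (C l) ℕ.* toℕ (A i l) ℕ.+ χ (W l))
      ≤⟨ sum-mono-except i (χ (W i)) off-diagonal (ℕₚ.+-monoˡ-≤ (χ (W i)) (χ-*-≤ (C i) _)) ⟩
    rowSum A i ℕ.+ χ (W i)
      ≡⟨ cong₂ ℕ._+_ (ℕₚ.*-identityˡ (rowSum A i)) (ℕₚ.*-identityˡ (χ (W i))) ⟨
    1 ℕ.* rowSum A i ℕ.+ 1 ℕ.* χ (W i) ∎
    where
    open ℕₚ.≤-Reasoning
    off-diagonal : ∀ l → l ≢ i → χ (C l) ℕ.* toℕ (A i l) ℕ.+ χ (W l) ℕ.≤ toℕ (A i l)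
    off-diagonal l l≢i with C l in l∉C | A i l in Aᵢₗ
    ... | true  | v  = ℕₚ.≤-reflexive (trans (ℕₚ.+-identityʳ _) (ℕₚ.*-identityˡ (toℕ v)))
    ... | false | 1F = ℕₚ.≤-refl
    ... | false | 0F = contradiction (k∈C , l∉C , Aᵢₖ≡1 , (l≢i ∘ sym) , Aᵢₗ) closed

  -- `row-count` summed over all rows, with the order of summation exchanged on the left.
  closed-count : sumOver C (colSum A) ℕ.+ size R ℕ.* size W ℕ.≤ sumOver R (rowSum A) ℕ.+ sumOver R (χ ∘ W)
  closed-count = begin
    sumOver C (colSum A) ℕ.+ size R ℕ.* size W
      ≡⟨ cong₂ ℕ._+_ by-rows (*-distribʳ-sum (size W) (χ ∘ R)) ⟩
    sum (λ i → sumOver C (toℕ ∘ A i)) ℕ.+ sum (λ i → χ (R i) ℕ.* size W)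
      ≡⟨ ∑-distrib-+ (λ i → sumOver C (toℕ ∘ A i)) (λ i → χ (R i) ℕ.* size W) ⟨
    sum (λ i → sumOver C (toℕ ∘ A i) ℕ.+ χ (R i) ℕ.* size W)
      ≤⟨ sum-mono-≤ row-count ⟩
    sum (λ i → χ (R i) ℕ.* rowSum A i ℕ.+ χ (R i) ℕ.* χ (W i))
      ≡⟨ ∑-distrib-+ (λ i → χ (R i) ℕ.* rowSum A i) (λ i → χ (R i) ℕ.* χ (W i)) ⟩
    sumOver R (rowSum A) ℕ.+ sumOver R (χ ∘ W) ∎
    where
    open ℕₚ.≤-Reasoning
    by-rows : sumOver C (colSum A) ≡ sum (λ i → sumOver C (toℕ ∘ A i))
    by-rows = trans (sum-cong-≗ (λ k → *-distribˡ-sum (χ (C k)) (λ i → toℕ (A i k))))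
                    (∑-comm (λ k i → χ (C k) ℕ.* toℕ (A i k)))

  -- `closed-count` is played against the cut condition for `R` and `W`. As `W` is the complement of
  -- `C`, the share of `b` over `W` cancels and the share over `C` remains.
  closed-colSum-≤ : {a b : Vector ℕ n} → Fulkerson a b → (∀ i → rowSum A i ≡ a i) →
    sumOver C (colSum A) ℕ.≤ sumOver C b
  closed-colSum-≤ {a} {b} cut rows = ℕₚ.+-cancelʳ-≤ (y ℕ.+ rw) _ _ (begin
    sumOver C (colSum A) ℕ.+ (y ℕ.+ rw)   ≡⟨ shuffle _ y rw ⟩
    sumOver C (colSum A) ℕ.+ rw ℕ.+ y     ≤⟨ ℕₚ.+-monoˡ-≤ y closed-count ⟩
    sumOver R (rowSum A) ℕ.+ z ℕ.+ y      ≡⟨ cong (λ x → x ℕ.+ z ℕ.+ y) (sum-cong-≗ (λ i → cong (χ (R i) ℕ.*_) (rows i))) ⟩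
    sumOver R a ℕ.+ z ℕ.+ y               ≡⟨ swap _ z y ⟩
    sumOver R a ℕ.+ y ℕ.+ z               ≤⟨ cut R W ⟩
    sum b ℕ.+ rw                          ≡⟨ cong (ℕ._+ rw) (sumOver-complement C b) ⟨
    sumOver C b ℕ.+ y ℕ.+ rw              ≡⟨ ℕₚ.+-assoc _ y rw ⟩
    sumOver C b ℕ.+ (y ℕ.+ rw)            ∎)
    where
    open ℕₚ.≤-Reasoning
    y z rw : ℕ
    y  = sumOver W b
    z  = sumOver R (χ ∘ W)
    rw = size R ℕ.* size W
    shuffle : ∀ x y z → x ℕ.+ (y ℕ.+ z) ≡ x ℕ.+ z ℕ.+ y
    shuffle = solve-∀

  -- If no column of `C` were too small, the surplus in column `s` would push the total over `C`
  -- above its prescribed value, against `closed-colSum-≤`.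
  deficient-column : {a b : Vector ℕ n} → Fulkerson a b → (∀ i → rowSum A i ≡ a i) →
    {s : Fin n} → C s ≡ true → b s ℕ.< colSum A s → ∃[ k ] C k ≡ true × colSum A k ℕ.< b k
  deficient-column {b = b} cut rows {s} s∈C bₛ<cₛ with any? (λ k → C k Bool.≟ true ×-dec colSum A k ℕ.<? b k)
  ... | yes found = found
  ... | no none   = contradiction (closed-colSum-≤ cut rows) (ℕₚ.<⇒≱ (sum-mono-< s below strict))
    where
    below : ∀ k → χ (C k) ℕ.* b k ℕ.≤ χ (C k) ℕ.* colSum A k
    below k with C k in k∈C
    ... | false = z≤n
    ... | true  = ℕₚ.*-monoʳ-≤ 1 (ℕₚ.≮⇒≥ λ cₖ<bₖ → none (k , k∈C , cₖ<bₖ))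
    strict : χ (C s) ℕ.* b s ℕ.< χ (C s) ℕ.* colSum A s
    strict rewrite s∈C = ℕₚ.*-monoʳ-< 1 bₛ<cₛ

-- Descent on the excess of the columns.

-- Truncated subtraction lets a column that is too small count as zero, so giving it a unit costs
-- nothing.
excess : ZeroOneMatrix n → Vector ℕ n → ℕ
excess A b = sum (λ j → colSum A j ∸ b j)

module _ {A : ZeroOneMatrix n} {b : Vector ℕ n} {s t : Fin n} {C : Vector Bool n} (ρ : Reroute A s C t)
  (bₛ<cₛ : b s ℕ.< colSum A s) (cₜ<bₜ : colSum A t ℕ.< b t) where

  open Reroute ρ

  -- Column `s` loses one unit of surplus, column `t` was strictly too small and so still has no
  -- surplus, and the other column sums are unchanged.
  excess-decreases : excess A′ b ℕ.< excess A b
  excess-decreases = sum-mono-< s below strict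
    where
    s≢t : s ≢ t
    s≢t refl = ℕₚ.<-asym bₛ<cₛ cₜ<bₜ

    cₛ≡1+c′ₛ : colSum A s ≡ suc (colSum A′ s)
    cₛ≡1+c′ₛ = begin
      colSum A s                ≡⟨ ℕₚ.+-identityʳ _ ⟨
      colSum A s ℕ.+ 0          ≡⟨ cong (colSum A s ℕ.+_) (δ-off (s≢t ∘ sym)) ⟨
      colSum A s ℕ.+ δ t s      ≡⟨ cols s ⟨
      colSum A′ s ℕ.+ δ s s     ≡⟨ cong (colSum A′ s ℕ.+_) (δ-diag s) ⟩
      colSum A′ s ℕ.+ 1         ≡⟨ ℕₚ.+-comm _ 1 ⟩
      suc (colSum A′ s)         ∎
      where open ≡-Reasoning

    strict : colSum A′ s ∸ b s ℕ.< colSum A s ∸ b s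
    strict = ℕₚ.∸-monoˡ-< (ℕₚ.≤-reflexive (sym cₛ≡1+c′ₛ))
      (ℕₚ.≤-pred (subst (b s ℕ.<_) cₛ≡1+c′ₛ bₛ<cₛ))

    below : ∀ j → colSum A′ j ∸ b j ℕ.≤ colSum A j ∸ b j
    below j with t ≟ j
    ... | yes refl = ℕₚ.≤-trans (ℕₚ.≤-reflexive (ℕₚ.m≤n⇒m∸n≡0 c′ₜ≤bₜ)) z≤n
      where
      c′ₜ≤bₜ : colSum A′ t ℕ.≤ b t
      c′ₜ≤bₜ = begin
        colSum A′ t               ≤⟨ ℕₚ.m≤m+n _ _ ⟩
        colSum A′ t ℕ.+ δ s t     ≡⟨ cols t ⟩
        colSum A t ℕ.+ δ t t      ≡⟨ cong (colSum A t ℕ.+_) (δ-diag t) ⟩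
        colSum A t ℕ.+ 1          ≡⟨ ℕₚ.+-comm _ 1 ⟩
        suc (colSum A t)          ≤⟨ cₜ<bₜ ⟩
        b t                       ∎
        where open ℕₚ.≤-Reasoning
    ... | no t≢j = ℕₚ.∸-monoˡ-≤ (b j) (begin
      colSum A′ j               ≤⟨ ℕₚ.m≤m+n _ _ ⟩
      colSum A′ j ℕ.+ δ s j     ≡⟨ cols j ⟩
      colSum A j ℕ.+ δ t j      ≡⟨ cong (colSum A j ℕ.+_) (δ-off t≢j) ⟩
      colSum A j ℕ.+ 0          ≡⟨ ℕₚ.+-identityʳ _ ⟩
      colSum A j                ∎)
      where open ℕₚ.≤-Reasoning

sum-≡⇒≗ : {f g : Vector ℕ n} → (∀ i → f i ℕ.≤ g i) → sum f ≡ sum g → ∀ i → f i ≡ g i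
sum-≡⇒≗ {f = f} {g} f≤g Σf≡Σg i with f i ℕ.<? g i
... | yes fᵢ<gᵢ = contradiction Σf≡Σg (ℕₚ.<⇒≢ (sum-mono-< i f≤g fᵢ<gᵢ))
... | no  fᵢ≮gᵢ = ℕₚ.≤-antisym (f≤g i) (ℕₚ.≮⇒≥ fᵢ≮gᵢ)

module _ {a b : Vector ℕ n} (cut : Fulkerson a b) (Σa≡Σb : sum a ≡ sum b) where

  -- Each round moves a unit from a column that is too large to one that is too small, preserving
  -- row sums and the zero diagonal. The excess bounds the number of rounds.
  correct-columns : ∀ fuel (A : ZeroOneMatrix n) → (∀ i → A i i ≡ 0F) → (∀ i → rowSum A i ≡ a i) →
    excess A b ℕ.< fuel → Graphic (a , b)
  correct-columns (suc fuel) A diag rows (s≤s bound) with any? (λ s → b s ℕ.<? colSum A s)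
  -- No column is too large and the totals agree, so every column sum is exact.
  ... | no none = A , (rows , sum-≡⇒≗ (λ j → ℕₚ.≮⇒≥ (λ lt → none (j , lt))) Σcols≡Σb) , diag
    where
    Σcols≡Σb : sum (colSum A) ≡ sum b
    Σcols≡Σb = trans (sum-colSum A) (trans (sum-cong-≗ rows) Σa≡Σb)
  ... | yes (s , bₛ<cₛ) =
    let C , s∈C , ρ , closed = saturate A diag s
        t , t∈C , cₜ<bₜ = deficient-column A C closed cut rows s∈C bₛ<cₛ
        open Reroute (ρ t t∈C) renaming (rows to rows′)
    in correct-columns fuel A′ diagonal (λ i → trans (rows′ i) (rows i))
         (ℕₚ.<-≤-trans (excess-decreases {b = b} (ρ t t∈C) bₛ<cₛ cₜ<bₜ) bound)

  fulkerson : Graphic (a , b)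
  fulkerson = correct-columns (suc (excess A b)) A
    (λ i → proj₁ (proj₂ (row i))) (λ i → proj₂ (proj₂ (row i))) ℕₚ.≤-refl
    where
    row : ∀ i → Σ[ r ∈ Vector (Fin 2) n ] r i ≡ 0F × sum (toℕ ∘ r) ≡ a i
    row i = row-avoiding i (a i) (cut⇒row<n cut i)
    A : ZeroOneMatrix n
    A i = proj₁ (row i)

-- From degree bounds to the cut condition.

lookup≤maximum : (f : Vector ℕ n) → ∀ i → f i ℕ.≤ maximum f
lookup≤maximum f zero    = ℕₚ.m≤m⊔n _ _
lookup≤maximum f (suc i) = ℕₚ.m≤n⇒m≤o⊔n (f 0F) (lookup≤maximum (f ∘ suc) i)

-- Here `r` and `w` stand for `|R|` and `|W|`, and `x`, `y`, `z` for `Σ_R a`, `Σ_W b` and `|R ∩ W|`.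
cut-arithmetic : ∀ {m r w Ma Mb x y z} →
  x ℕ.≤ m → x ℕ.≤ r ℕ.* Ma → y ℕ.≤ m → y ℕ.≤ w ℕ.* Mb → z ℕ.≤ r → z ℕ.≤ w →
  (Ma ℕ.+ 1) ℕ.* Mb ℕ.≤ m → x ℕ.+ y ℕ.+ z ℕ.≤ m ℕ.+ r ℕ.* w
cut-arithmetic {m} {r} {w} {Ma} {Mb} {x} {y} {z} x≤m x≤rMa y≤m y≤wMb z≤r z≤w M≤m
  with suc Mb ℕ.≤? r | suc Ma ℕ.≤? w
... | yes Mb<r | _ = begin
  x ℕ.+ y ℕ.+ z                 ≡⟨ ℕₚ.+-assoc x y z ⟩
  -- Each column of `W` costs at most `Mb + 1`, the extra one coming from `z ≤ w`, and `Mb + 1 ≤ r`.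
  x ℕ.+ (y ℕ.+ z)               ≤⟨ ℕₚ.+-mono-≤ x≤m (ℕₚ.+-mono-≤ y≤wMb z≤w) ⟩
  m ℕ.+ (w ℕ.* Mb ℕ.+ w)        ≡⟨ cong (m ℕ.+_) (trans (ℕₚ.+-comm _ w) (sym (ℕₚ.*-suc w Mb))) ⟩
  m ℕ.+ w ℕ.* suc Mb            ≤⟨ ℕₚ.+-monoʳ-≤ m (ℕₚ.*-monoʳ-≤ w Mb<r) ⟩
  m ℕ.+ w ℕ.* r                 ≡⟨ cong (m ℕ.+_) (ℕₚ.*-comm w r) ⟩
  m ℕ.+ r ℕ.* w                 ∎
  where open ℕₚ.≤-Reasoning
... | no _ | yes Ma<w = begin
  x ℕ.+ y ℕ.+ z                 ≡⟨ cong (ℕ._+ z) (ℕₚ.+-comm x y) ⟩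
  y ℕ.+ x ℕ.+ z                 ≡⟨ ℕₚ.+-assoc y x z ⟩
  y ℕ.+ (x ℕ.+ z)               ≤⟨ ℕₚ.+-mono-≤ y≤m (ℕₚ.+-mono-≤ x≤rMa z≤r) ⟩
  m ℕ.+ (r ℕ.* Ma ℕ.+ r)        ≡⟨ cong (m ℕ.+_) (trans (ℕₚ.+-comm _ r) (sym (ℕₚ.*-suc r Ma))) ⟩
  m ℕ.+ r ℕ.* suc Ma            ≤⟨ ℕₚ.+-monoʳ-≤ m (ℕₚ.*-monoʳ-≤ r Ma<w) ⟩
  m ℕ.+ r ℕ.* w                 ∎
  where open ℕₚ.≤-Reasoning
... | no Mb≮r | no Ma≮w
  -- With `Ma = w + u` and `Mb = r + v`, the gap between the two sides of the needed inequality is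
  -- exactly `u v + v`.
  with u , refl ← ℕₚ.m≤n⇒∃[o]m+o≡n (ℕₚ.≮⇒≥ Ma≮w)
     | v , refl ← ℕₚ.m≤n⇒∃[o]m+o≡n (ℕₚ.≮⇒≥ Mb≮r) = begin
  x ℕ.+ y ℕ.+ z                                     ≤⟨ ℕₚ.+-mono-≤ (ℕₚ.+-mono-≤ x≤rMa y≤wMb) z≤r ⟩
  r ℕ.* (w ℕ.+ u) ℕ.+ w ℕ.* (r ℕ.+ v) ℕ.+ r         ≤⟨ ℕₚ.m≤m+n _ (u ℕ.* v ℕ.+ v) ⟩
  r ℕ.* (w ℕ.+ u) ℕ.+ w ℕ.* (r ℕ.+ v) ℕ.+ r ℕ.+ (u ℕ.* v ℕ.+ v)
                                                    ≡⟨ expand r w u v ⟩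
  (w ℕ.+ u ℕ.+ 1) ℕ.* (r ℕ.+ v) ℕ.+ r ℕ.* w         ≤⟨ ℕₚ.+-monoˡ-≤ (r ℕ.* w) M≤m ⟩
  m ℕ.+ r ℕ.* w                                     ∎
  where
  open ℕₚ.≤-Reasoning
  expand : ∀ r w u v → r ℕ.* (w ℕ.+ u) ℕ.+ w ℕ.* (r ℕ.+ v) ℕ.+ r ℕ.+ (u ℕ.* v ℕ.+ v)
    ≡ (w ℕ.+ u ℕ.+ 1) ℕ.* (r ℕ.+ v) ℕ.+ r ℕ.* w
  expand = solve-∀

degree-bounds⇒graphic : {a b : Vector ℕ n} {Ma Mb : ℕ} → sum a ≡ sum b →
  maximum a ℕ.≤ Ma → maximum b ℕ.≤ Mb → (Ma ℕ.+ 1) ℕ.* Mb ℕ.≤ sum b → Graphic (a , b)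
degree-bounds⇒graphic {a = a} {b} {Ma} {Mb} Σa≡Σb a≤Ma b≤Mb M≤Σb = fulkerson cut Σa≡Σb
  where
  χ≤1 : ∀ x → χ x ℕ.≤ 1
  χ≤1 false = z≤n
  χ≤1 true  = ℕₚ.≤-refl
  cut : Fulkerson a b
  cut R W = cut-arithmetic {r = size R} {size W} {Ma} {Mb}
    (subst (sumOver R a ℕ.≤_) Σa≡Σb (sumOver-≤-sum R a))
    (sumOver-≤-* R a Ma (λ i → ℕₚ.≤-trans (lookup≤maximum a i) a≤Ma))
    (sumOver-≤-sum W b)
    (sumOver-≤-* W b Mb (λ i → ℕₚ.≤-trans (lookup≤maximum b i) b≤Mb))
    (subst (sumOver R (χ ∘ W) ℕ.≤_) (ℕₚ.*-identityʳ (size R)) (sumOver-≤-* R (χ ∘ W) 1 (χ≤1 ∘ W)))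
    (sumOver-≤-sum R (χ ∘ W))
    M≤Σb

-- Natural numbers as rationals, and the square-root bound.

-- The quotient `+ m / 1` is normalised by a gcd that is stuck on a variable `m`; the constructor
-- form lets rational arithmetic and order compute.
fromℕ≡mkℚ : ∀ m → fromℕ m ≡ mkℚ (ℤ.+ m) 0 (Coprimality.sym (Coprimality.1-coprimeTo m))
fromℕ≡mkℚ m = ℚₚ.normalize-coprime (Coprimality.sym (Coprimality.1-coprimeTo m))

fromℕ-+ : ∀ m k → fromℕ (m ℕ.+ k) ≡ fromℕ m + fromℕ k
fromℕ-+ m k rewrite fromℕ≡mkℚ m | fromℕ≡mkℚ k =
  cong (_/ 1) (sym (cong₂ ℤ._+_ (ℤₚ.*-identityʳ (ℤ.+ m)) (ℤₚ.*-identityʳ (ℤ.+ k))))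

fromℕ-* : ∀ m k → fromℕ (m ℕ.* k) ≡ fromℕ m * fromℕ k
fromℕ-* m k rewrite fromℕ≡mkℚ m | fromℕ≡mkℚ k = cong (_/ 1) (ℤₚ.pos-* m k)

fromℕ-mono-≤ : ∀ {m k} → m ℕ.≤ k → fromℕ m ≤ fromℕ k
fromℕ-mono-≤ {m} {k} m≤k rewrite fromℕ≡mkℚ m | fromℕ≡mkℚ k =
  *≤* (ℤₚ.*-monoʳ-≤-nonNeg (ℤ.+ 1) (ℤ.+≤+ m≤k))

fromℕ-cancel-≤ : ∀ {m k} → fromℕ m ≤ fromℕ k → m ℕ.≤ k
fromℕ-cancel-≤ {m} {k} m≤k rewrite fromℕ≡mkℚ m | fromℕ≡mkℚ k =
  ℤₚ.drop‿+≤+ (subst₂ ℤ._≤_ (ℤₚ.*-identityʳ (ℤ.+ m)) (ℤₚ.*-identityʳ (ℤ.+ k)) (ℚₚ.drop-*≤* m≤k))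

fromℕ-cancel-< : ∀ {m k} → fromℕ m < fromℕ k → m ℕ.< k
fromℕ-cancel-< m<k = ℕₚ.≰⇒> (λ k≤m → ℚₚ.<-irrefl refl (ℚₚ.<-≤-trans m<k (fromℕ-mono-≤ k≤m)))

fromℕ-injective : ∀ {m k} → fromℕ m ≡ fromℕ k → m ≡ k
fromℕ-injective eq = ℕₚ.≤-antisym (fromℕ-cancel-≤ (ℚₚ.≤-reflexive eq)) (fromℕ-cancel-≤ (ℚₚ.≤-reflexive (sym eq)))

-- The inclusion of Dedekind cuts is tested at q = M − ε with ε = 1 / (2M + 1): then
-- (q + ½)² = M² + M + ¼ − 1 + ε², and integrality absorbs the error ε² − 1.
sqrt-bound : ∀ M m → fromℚ (fromℕ M) ≤ᴿ √ (¼ + fromℕ m) -ᴿ ½ → (M ℕ.+ 1) ℕ.* M ℕ.≤ m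
-- For `M = 0` the test point has `q + ½ = -½`, which lies in the cut of every square root and says
-- nothing; the bound itself is trivial.
sqrt-bound zero      m _     = z≤n
sqrt-bound M@(suc _) m below = case below (x - ε) x-ε<x of λ where
    -- The negative part of the cut is excluded, since `ε ≤ 1 ≤ M`.
    (inj₁ q+½<0)  → contradiction (ℚₚ.<-≤-trans q+½<0 0≤q+½) (ℚₚ.<-irrefl refl)
    (inj₂ q+½²<r) → ℕₚ.≤-pred (fromℕ-cancel-< (begin-strict
      fromℕ ((M ℕ.+ 1) ℕ.* M)                    ≡⟨ fromℕ-* (M ℕ.+ 1) M ⟩
      fromℕ (M ℕ.+ 1) * x                        ≡⟨ cong (_* x) (fromℕ-+ M 1) ⟩
      (x + 1ℚ) * x                               ≡⟨ ℚₚ.+-identityʳ _ ⟨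
      (x + 1ℚ) * x + 0ℚ                          ≤⟨ ℚₚ.+-monoʳ-≤ ((x + 1ℚ) * x) (ℚₚ.<⇒≤ (ℚₚ.positive⁻¹ (ε * ε))) ⟩
      (x + 1ℚ) * x + ε * ε                       ≡⟨ square ⟨
      (x - ε + ½) * (x - ε + ½) + (1ℚ - ¼)       <⟨ ℚₚ.+-monoˡ-< (1ℚ - ¼) q+½²<r ⟩
      ¼ + fromℕ m + (1ℚ - ¼)                     ≡⟨ solve 1 (λ y → con ¼ :+ y :+ (con 1ℚ :- con ¼) := con 1ℚ :+ y) refl (fromℕ m) ⟩
      1ℚ + fromℕ m                               ≡⟨ fromℕ-+ 1 m ⟨
      fromℕ (suc m)                              ∎))
  where
  open ℚₚ.≤-Reasoning
  open +-*-Solver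
  x N ε : ℚ
  x = fromℕ M
  -- `2M + 1` in constructor form, so that its reciprocal `ε` computes.
  N = mkℚ (ℤ.+ suc (M ℕ.+ M)) 0 (Coprimality.sym (Coprimality.1-coprimeTo (suc (M ℕ.+ M))))
  ε = 1/ N
  instance
    ε² : Positive (ε * ε)
    ε² = ℚₚ.pos*pos⇒pos ε ε

  x-ε<x : x - ε < x
  x-ε<x = begin-strict
    x - ε       <⟨ ℚₚ.+-monoʳ-< x (ℚₚ.neg-antimono-< (ℚₚ.positive⁻¹ ε)) ⟩
    x + 0ℚ      ≡⟨ ℚₚ.+-identityʳ x ⟩
    x           ∎

  0≤q+½ : 0ℚ ≤ x - ε + ½
  0≤q+½ = begin
    0ℚ              ≡⟨⟩
    1ℚ - 1ℚ + 0ℚ    ≤⟨ ℚₚ.+-mono-≤ (ℚₚ.+-mono-≤ (fromℕ-mono-≤ {1} {M} (s≤s z≤n)) (ℚₚ.neg-antimono-≤ ε≤1))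
                         (ℚₚ.<⇒≤ (ℚₚ.positive⁻¹ ½)) ⟩
    x - ε + ½       ∎
    where
    ε≤1 : ε ≤ 1ℚ
    ε≤1 = *≤* (ℤ.+≤+ (s≤s z≤n))

  2x+1*ε≡1 : (1ℚ + (x + x)) * ε ≡ 1ℚ
  2x+1*ε≡1 = trans (cong (_* ε) (trans (sym (trans (fromℕ-+ 1 (M ℕ.+ M)) (cong (1ℚ +_) (fromℕ-+ M M))))
    (fromℕ≡mkℚ (suc (M ℕ.+ M))))) (ℚₚ.*-inverseʳ N)

  -- Expansion leaves the extra term `1 - (1 + 2x) ε`, which vanishes by the choice of `ε`.
  square : (x - ε + ½) * (x - ε + ½) + (1ℚ - ¼) ≡ (x + 1ℚ) * x + ε * ε
  square = trans
    (solve 2 (λ x ε → (x :- ε :+ con ½) :* (x :- ε :+ con ½) :+ (con 1ℚ :- con ¼)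
                    := (x :+ con 1ℚ) :* x :+ ε :* ε :+ (con 1ℚ :- (con 1ℚ :+ (x :+ x)) :* ε)) refl x ε)
    (trans (cong (λ y → (x + 1ℚ) * x + ε * ε + (1ℚ - y)) 2x+1*ε≡1) (ℚₚ.+-identityʳ _))

theorem4 : ∀ (n : ℕ) (a b : Vector ℕ n) (c̄ : ℚ) →
    fromℕ (sum a) ≡ fromℕ n * c̄ →
    fromℕ (sum b) ≡ fromℕ n * c̄ →
    (∀ (Ma Mb : ℕ) →
    maximum a ℕ.≤ Ma →
    maximum b ℕ.≤ Mb →
    fromℕ ((Ma ℕ.+ 1) ℕ.* Mb) ≤ fromℕ n * c̄ →
    Graphic (a , b))
    ×
    (fromℚ (fromℕ (maxDegree (a , b))) ≤ᴿ √ (¼ + fromℕ n * c̄) -ᴿ ½ →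
    Graphic (a , b))
-- The second claim takes the overall maximum `M` for both degree bounds.
theorem4 n a b c̄ Σa≡nc̄ Σb≡nc̄ = bounded , λ M≤√ → degree-bounds⇒graphic Σa≡Σb
    (ℕₚ.m≤m⊔n _ _) (ℕₚ.m≤n⊔m (maximum a) _)
    (sqrt-bound M (sum b) (subst (λ r → fromℚ (fromℕ M) ≤ᴿ √ (¼ + r) -ᴿ ½) (sym Σb≡nc̄) M≤√))
  where
  M : ℕ
  M = maxDegree (a , b)
  Σa≡Σb : sum a ≡ sum b
  Σa≡Σb = fromℕ-injective (trans Σa≡nc̄ (sym Σb≡nc̄))
  bounded : ∀ Ma Mb → maximum a ℕ.≤ Ma → maximum b ℕ.≤ Mb →
    fromℕ ((Ma ℕ.+ 1) ℕ.* Mb) ≤ fromℕ n * c̄ → Graphic (a , b)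
  bounded Ma Mb a≤Ma b≤Mb M≤nc̄ = degree-bounds⇒graphic Σa≡Σb a≤Ma b≤Mb
    (fromℕ-cancel-≤ (subst (fromℕ ((Ma ℕ.+ 1) ℕ.* Mb) ≤_) (sym Σb≡nc̄) M≤nc̄))
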